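{- Let $G$ be an elementary abelian group, i.e. the additive group of a finite field $\mathbb{F}_q$. Then any $(q,k,\lambda)$ difference set in $G$ extends to dimension $q$.
   Context: A $(v,k,\lambda)$ difference set in an additively written group $G$ of order $v$ is a $k$-subset $D\subseteq G$ such that every $g\in G\setminus\{0\}$ can be written as $g=a-b$ with $a,b\in D$ in exactly $\lambda$ ways. An $n$-dimensional $(v,k,\lambda)$ difference set in $G$ is a $k$-subset $E\subseteq G^n$ of $n$-tuples such that for every pair of coordinates $1\le x<y\le n$ the set $\{e_x-e_y\mid e\in E\}$ is a $(v,k,\lambda)$ difference set in $G$. A $(v,k,\lambda)$ difference set $D\subseteq G$ extends to dimension $n$ if there is an $n$-dimensional $(v,k,\lambda)$ difference set $E\subseteq G^n$ and two distinct coordinates $x\ne y$ such that $D=\{e_x-e_y\mid e\in E\}$. -}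

module Defs where

open import Algebra.Apartness.Bundles using (HeytingField; HeytingCommutativeRing)
open import Algebra.Bundles using (Group; CommutativeRing)
open import Data.Fin.Base using (Fin; _<_)
open import Data.Nat.Base using (ℕ)
open import Data.Product.Base using (Σ; ∃; ∃₂; _×_; _,_; proj₁)
open import Data.Product.Relation.Binary.Pointwise.NonDependent using (×-setoid)
open import Data.Vec.Functional using (Vector)
open import Data.Vec.Functional.Relation.Binary.Equality.Setoid using (≋-setoid)
open import Function.Bundles using (Inverse)
open import Level using (Level; _⊔_)
open import Relation.Binary.Bundles using (Setoid)
open import Relation.Binary.Definitions using (_Respects_)
open import Relation.Binary.PropositionalEquality using (_≢_; setoid)
import Relation.Binary.Construct.On as On
open import Relation.Nullary.Negation using (¬_)
open import Relation.Unary using (Pred; _∈_; _≐_)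

private
  variable
    c ℓ ℓ₁ ℓ₂ p : Level

HasCardinality : Setoid c ℓ → ℕ → Set (c ⊔ ℓ)
HasCardinality S n = Inverse S (setoid (Fin n))

-- Two members of a subset are identified when their underlying elements are
-- equal, so different proofs of membership are not counted separately.
subsetoid : (S : Setoid c ℓ) → Pred (Setoid.Carrier S) p → Setoid (c ⊔ p) ℓ
subsetoid S P = On.setoid {B = Σ (Setoid.Carrier S) P} S proj₁

record IsSubsetOfSize (S : Setoid c ℓ) (k : ℕ) (P : Pred (Setoid.Carrier S) p)
       : Set (c ⊔ ℓ ⊔ p) where
  field
    respects    : P Respects (Setoid._≈_ S)
    cardinality : HasCardinality (subsetoid S P) k

-- The library writes groups multiplicatively: a // b = a ∙ b ⁻¹ is the
-- difference a − b, and ε is the zero element.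
module _ (G : Group c ℓ) where
  open Group G using (Carrier; _≈_; _//_; ε) renaming (setoid to Gₛ)

  Representations : Pred Carrier p → Carrier → Pred (Carrier × Carrier) (ℓ ⊔ p)
  Representations D g (a , b) = a ∈ D × b ∈ D × g ≈ a // b

  record IsDifferenceSet (v k λ′ : ℕ) (D : Pred Carrier p) : Set (c ⊔ ℓ ⊔ p) where
    field
      order           : HasCardinality Gₛ v
      size            : IsSubsetOfSize Gₛ k D
      representations : ∀ g → ¬ (g ≈ ε) →
        HasCardinality (subsetoid (×-setoid Gₛ Gₛ) (Representations D g)) λ′

  Differences : ∀ {n} → Pred (Vector Carrier n) p → Fin n → Fin n →
                Pred Carrier (c ⊔ ℓ ⊔ p)
  Differences E x y g = ∃ λ e → e ∈ E × g ≈ e x // e y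

  record IsDifferenceSetOfDim (n v k λ′ : ℕ) (E : Pred (Vector Carrier n) p)
         : Set (c ⊔ ℓ ⊔ p) where
    field
      size        : IsSubsetOfSize (≋-setoid Gₛ n) k E
      differences : ∀ x y → x < y → IsDifferenceSet v k λ′ (Differences E x y)

  -- Universe levels force a choice for E; this one admits every set of tuples
  -- {t | ∃ d ∈ D, t ≈ φ d}, as does any larger one.
  ExtendsToDimension : (n v k λ′ : ℕ) → Pred Carrier p → Set _
  ExtendsToDimension {p = p} n v k λ′ D =
    ∃ λ (E : Pred (Vector Carrier n) (c ⊔ ℓ ⊔ p)) →
      IsDifferenceSetOfDim n v k λ′ E ×
      ∃₂ λ x y → x ≢ y × D ≐ Differences E x y

-- For a finite carrier, equality and invertibility are decidable, so a Heyting
-- field of order q is a field in the usual sense: apartness is then inequality,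
-- every element not equal to 0 is invertible, and 0 is not equal to 1.
IsFiniteFieldOfOrder : HeytingField c ℓ₁ ℓ₂ → ℕ → Set (c ⊔ ℓ₁)
IsFiniteFieldOfOrder F q = HasCardinality (CommutativeRing.setoid R) q
  where R = HeytingCommutativeRing.commutativeRing (HeytingField.heytingCommutativeRing F)

additiveGroup : HeytingField c ℓ₁ ℓ₂ → Group c ℓ₁
additiveGroup F = CommutativeRing.+-group
  (HeytingCommutativeRing.commutativeRing (HeytingField.heytingCommutativeRing F))

{-# OPTIONS --safe #-}

-- Enumerate the field as α₀, …, α_{q−1} and take E = {(αᵢ d)ᵢ | d ∈ D}.  The
-- differences of coordinates x and y form the set (α_x − α_y) D, the image of D
-- under an automorphism of the additive group, hence again a difference set.
-- The coordinates at which α is 1 and 0 recover D itself.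
module Submission where

open import Defs
open import Algebra.Apartness.Bundles using (HeytingField; HeytingCommutativeRing)
open import Algebra.Bundles using (Group; CommutativeRing)
open import Data.Fin.Base using (Fin)
open import Data.Nat.Base using (ℕ)
open import Level using (Level; _⊔_)
open import Relation.Unary using (Pred)
open import Algebra.Apartness.Properties.HeytingCommutativeRing using (1#0; x-0≈x)
open import Algebra.Definitions using (LeftInvertible)
import Algebra.Properties.Group as GroupProperties
import Algebra.Properties.Ring as RingProperties
import Data.Fin.Properties as Fin
open import Data.Product.Base using (∃; _×_; _,_; proj₁; proj₂; map)
open import Data.Product.Relation.Binary.Pointwise.NonDependent using (×-setoid)
open import Data.Vec.Functional using (Vector)
open import Data.Vec.Functional.Relation.Binary.Equality.Setoid using (≋-setoid)
open import Function.Bundles using (Inverse; Injection)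
open import Function.Construct.Composition using () renaming (inverse to inverse-trans)
open import Function.Construct.Symmetry using () renaming (inverse to inverse-sym)
open import Function.Definitions using (Congruent)
open import Function.Properties.Inverse using (Inverse⇒Injection)
open import Relation.Binary.Bundles using (Setoid)
open import Relation.Binary.Definitions using (Decidable)
open import Relation.Binary.PropositionalEquality using (_≢_)
import Relation.Binary.Reasoning.Setoid as ≈-Reasoning
open import Relation.Nullary.Decidable using (Dec; map′; decidable-stable; via-injection)
open import Relation.Nullary.Negation using (¬_)
open import Relation.Unary using (_∈_; _≐_; _⊢_)

private
  variable
    a ℓ₁ b ℓ₂ p r : Level

module _ (S : Setoid a ℓ₁) (T : Setoid b ℓ₂) where
  private
    module S = Setoid S
    module T = Setoid T

  -- Equality in a `subsetoid` ignores membership proofs, so mutually inverse maps of the underlying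
  -- elements suffice. The round trips are asked of members alone: reading one coordinate of a tuple
  -- is invertible only on a suitable set of tuples.
  subset-inverse : {P : Pred S.Carrier p} {Q : Pred T.Carrier r}
    (f : S.Carrier → T.Carrier) (g : T.Carrier → S.Carrier) →
    Congruent S._≈_ T._≈_ f → Congruent T._≈_ S._≈_ g →
    (∀ {x} → x ∈ P → f x ∈ Q) → (∀ {y} → y ∈ Q → g y ∈ P) →
    (∀ {x} → x ∈ P → g (f x) S.≈ x) → (∀ {y} → y ∈ Q → f (g y) T.≈ y) →
    Inverse (subsetoid S P) (subsetoid T Q)
  subset-inverse f g f-cong g-cong P⇒Q Q⇒P gf fg = record
    { to        = λ (x , x∈P) → f x , P⇒Q x∈P
    ; from      = λ (y , y∈Q) → g y , Q⇒P y∈Q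
    ; to-cong   = f-cong
    ; from-cong = g-cong
    ; inverse   = (λ {(y , y∈Q)} x≈gy → T.trans (f-cong x≈gy) (fg y∈Q))
                , (λ {(x , x∈P)} y≈fx → S.trans (g-cong y≈fx) (gf x∈P))
    }

module _ (G : Group a ℓ₁) where
  open Group G renaming (setoid to Gₛ)
  open GroupProperties G using (//-cong₂)

  -- Applying `to` to both entries turns representations of `g` in `D′` into representations of
  -- `to g` in `D`, bijectively, and `to g` is nonzero whenever `g` is. Stating `D′` up to `≐` lets
  -- it be a set of coordinate differences, whose universe level differs from that of `D`.
  preimage-isDifferenceSet : ∀ {v k λ′} {D : Pred Carrier p} {D′ : Pred Carrier r}
    (σ : Inverse Gₛ Gₛ) → let open Inverse σ using (to) in
    (∀ x y → to (x // y) ≈ to x // to y) → D′ ≐ (to ⊢ D) →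
    IsDifferenceSet G v k λ′ D → IsDifferenceSet G v k λ′ D′
  preimage-isDifferenceSet {k = k} {λ′} {D} {D′} σ to-// (D′⊆ , ⊆D′) isD = record
    { order = order
    ; size = record
      { respects    = λ x≈y x∈D′ → ⊆D′ (respects (to-cong x≈y) (D′⊆ x∈D′))
      ; cardinality = inverse-trans
          (subset-inverse Gₛ Gₛ to from to-cong from-cong D′⊆ from-D′
            (λ _ → strictlyInverseʳ _) (λ _ → strictlyInverseˡ _))
          cardinality
      }
    ; representations = λ g g≉ε → inverse-trans
        (subset-inverse Gₛ² Gₛ² (map to to) (map from from)
          (map to-cong to-cong) (map from-cong from-cong)
          (λ {(x , y)} (x∈D′ , y∈D′ , g≈x//y) →
            D′⊆ x∈D′ , D′⊆ y∈D′ , trans (to-cong g≈x//y) (to-// x y))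
          -- The equation for `g` is checked after applying the injective `to`, as it is `to` that
          -- is known to preserve differences.
          (λ {(x , y)} (x∈D , y∈D , to-g≈x//y) →
            from-D′ x∈D , from-D′ y∈D , to-injective (begin
              to g                       ≈⟨ to-g≈x//y ⟩
              x // y                     ≈⟨ //-cong₂ (strictlyInverseˡ x) (strictlyInverseˡ y) ⟨
              to (from x) // to (from y) ≈⟨ to-// (from x) (from y) ⟨
              to (from x // from y)      ∎))
          (λ _ → strictlyInverseʳ _ , strictlyInverseʳ _)
          (λ _ → strictlyInverseˡ _ , strictlyInverseˡ _))
        (representations (to g) (λ to-g≈ε → g≉ε (to-injective (trans to-g≈ε (sym to-ε)))))
    }
    where
    open Inverse σ using (to; from; to-cong; from-cong; strictlyInverseˡ; strictlyInverseʳ)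
    open IsDifferenceSet isD
    open IsSubsetOfSize size
    open ≈-Reasoning Gₛ
    Gₛ² = ×-setoid Gₛ Gₛ

    to-injective : ∀ {x y} → to x ≈ to y → x ≈ y
    to-injective = Injection.injective (Inverse⇒Injection σ)

    from-D′ : ∀ {x} → x ∈ D → from x ∈ D′
    from-D′ x∈D = ⊆D′ (respects (sym (strictlyInverseˡ _)) x∈D)

    to-ε : to ε ≈ ε
    to-ε = begin
      to ε         ≈⟨ to-cong (inverseʳ ε) ⟨
      to (ε // ε)  ≈⟨ to-// ε ε ⟩
      to ε // to ε ≈⟨ inverseʳ (to ε) ⟩
      ε            ∎

module FiniteField {c ℓ₁ ℓ₂ : Level} (F : HeytingField c ℓ₁ ℓ₂) {q : ℕ}
                   (order : IsFiniteFieldOfOrder F q) where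
  open HeytingField F using (heytingCommutativeRing; #⇒invertible; tight)
  open CommutativeRing (HeytingCommutativeRing.commutativeRing heytingCommutativeRing)
  open RingProperties ring using (x[y-z]≈xy-xz; [y-z]x≈yx-zx)
  open ≈-Reasoning setoid

  element : Fin q → Carrier
  element = Inverse.from order

  index : Carrier → Fin q
  index = Inverse.to order

  element-index : ∀ x → element (index x) ≈ x
  element-index = Inverse.strictlyInverseʳ order

  _≟_ : Decidable _≈_
  _≟_ = via-injection (Inverse⇒Injection order) Fin._≟_

  -- The enumeration turns the search for an inverse into a search over `Fin q` for a solution of a
  -- decidable equation.
  leftInvertible? : ∀ x → Dec (LeftInvertible _≈_ 1# _*_ x)
  leftInvertible? x = map′
    (λ (i , eq) → element i , eq)
    (λ (y , eq) → index y , trans (*-congʳ (element-index y)) eq)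
    (Fin.any? (λ i → (element i * x) ≟ 1#))

  -- Tightness of # only gives ¬ ¬ (x # y); searching the finite field for an
  -- inverse removes the double negation.
  ≉⇒leftInvertible : ∀ {x y} → ¬ (x ≈ y) → LeftInvertible _≈_ 1# _*_ (x - y)
  ≉⇒leftInvertible {x} {y} x≉y = decidable-stable (leftInvertible? (x - y)) λ ¬inv →
    x≉y (proj₁ (tight x y) λ x#y → let z , eq , _ = #⇒invertible x#y in ¬inv (z , eq))

  element-≉ : ∀ {i j} → i ≢ j → ¬ (element i ≈ element j)
  element-≉ i≢j αi≈αj = i≢j (Injection.injective (Inverse⇒Injection (inverse-sym order)) αi≈αj)

  cancel : ∀ {u v} x → u * v ≈ 1# → u * (v * x) ≈ x
  cancel {u} {v} x uv≈1 = begin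
    u * (v * x) ≈⟨ *-assoc u v x ⟨
    u * v * x   ≈⟨ *-congʳ uv≈1 ⟩
    1# * x      ≈⟨ *-identityˡ x ⟩
    x           ∎

  scaling : ∀ {u v} → u * v ≈ 1# → Inverse setoid setoid
  scaling {u} {v} uv≈1 = record
    { to        = u *_
    ; from      = v *_
    ; to-cong   = *-congˡ
    ; from-cong = *-congˡ
    ; inverse   = (λ {x} y≈vx → trans (*-congˡ y≈vx) (cancel x uv≈1))
                -- Commutativity makes the one-sided inverse two-sided.
                , (λ {x} y≈ux → trans (*-congˡ y≈ux) (cancel x (trans (*-comm v u) uv≈1)))
    }

  multiples : Carrier → Vector Carrier q
  multiples d i = element i * d

  multiples-difference : ∀ d x y →
    multiples d x - multiples d y ≈ (element x - element y) * d
  multiples-difference d x y = sym ([y-z]x≈yx-zx d (element x) (element y))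

  zeroᵢ oneᵢ : Fin q
  zeroᵢ = index 0#
  oneᵢ  = index 1#

  multiples-one : ∀ d → multiples d oneᵢ ≈ d
  multiples-one d = trans (*-congʳ (element-index 1#)) (*-identityˡ d)

  one-zero≈1 : element oneᵢ - element zeroᵢ ≈ 1#
  one-zero≈1 = begin
    element oneᵢ - element zeroᵢ ≈⟨ +-cong (element-index 1#) (-‿cong (element-index 0#)) ⟩
    1# - 0#                      ≈⟨ x-0≈x heytingCommutativeRing 1# ⟩
    1#                           ∎

  oneᵢ≢zeroᵢ : oneᵢ ≢ zeroᵢ
  oneᵢ≢zeroᵢ eq =
    proj₂ (tight 1# 0#) (Injection.injective (Inverse⇒Injection order) eq) (1#0 heytingCommutativeRing)

  module _ {k λ′ : ℕ} {D : Pred Carrier p}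
           (isD : IsDifferenceSet +-group q k λ′ D) where
    open IsDifferenceSet isD using (size)
    open IsSubsetOfSize size using (respects; cardinality)

    -- Tuples are compared with `multiples d` up to pointwise `≈`, which makes the set closed under
    -- equality of tuples.
    Multiples : Pred (Vector Carrier q) (c ⊔ ℓ₁ ⊔ p)
    Multiples t = ∃ λ d → d ∈ D × (∀ i → t i ≈ multiples d i)

    Multiples-size : IsSubsetOfSize (≋-setoid setoid q) k Multiples
    Multiples-size = record
      { respects = λ s≋t (d , d∈D , s≋) → d , d∈D , λ i → trans (sym (s≋t i)) (s≋ i)
      ; cardinality = inverse-trans
          -- The coordinate at which the scalar is 1 reads `d` back from its tuple, so distinct `d`
          -- give distinct tuples.
          (subset-inverse (≋-setoid setoid q) setoid (λ t → t oneᵢ) multiples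
            (λ s≋t → s≋t oneᵢ) (λ d≈e _ → *-congˡ d≈e)
            (λ (d , d∈D , t≋) → respects (sym (at-one d t≋)) d∈D)
            (λ {d} d∈D → d , d∈D , λ _ → refl)
            (λ (d , d∈D , t≋) i → trans (*-congˡ (at-one d t≋)) (sym (t≋ i)))
            (λ {d} _ → multiples-one d))
          cardinality
      }
      where
      at-one : ∀ {t : Vector Carrier q} d → (∀ i → t i ≈ multiples d i) → t oneᵢ ≈ d
      at-one d t≋ = trans (t≋ oneᵢ) (multiples-one d)

    -- The image of `D` under a unit is the preimage of `D` under its inverse `u`, the form that
    -- `preimage-isDifferenceSet` takes. The coordinates are arbitrary because the order of `oneᵢ`
    -- and `zeroᵢ` depends on the enumeration.
    Multiples-differences : ∀ x y {u} → u * (element x - element y) ≈ 1# →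
      Differences +-group Multiples x y ≐ ((u *_) ⊢ D)
    Multiples-differences x y {u} uv≈1 = ⊆ , ⊇
      where
      v = element x - element y

      ⊆ : ∀ {g} → g ∈ Differences +-group Multiples x y → u * g ∈ D
      ⊆ {g} (t , (d , d∈D , t≋) , g≈tx-ty) = respects (sym (begin
        u * g                               ≈⟨ *-congˡ g≈tx-ty ⟩
        u * (t x - t y)                     ≈⟨ *-congˡ (+-cong (t≋ x) (-‿cong (t≋ y))) ⟩
        u * (multiples d x - multiples d y) ≈⟨ *-congˡ (multiples-difference d x y) ⟩
        u * (v * d)                         ≈⟨ cancel d uv≈1 ⟩
        d                                   ∎)) d∈D

      ⊇ : ∀ {g} → u * g ∈ D → g ∈ Differences +-group Multiples x y
      -- The witness `u * g` is the solution `d` of `v * d ≈ g`.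
      ⊇ {g} ug∈D = multiples (u * g) , (u * g , ug∈D , λ _ → refl) , (begin
        g                                         ≈⟨ cancel g (trans (*-comm v u) uv≈1) ⟨
        v * (u * g)                               ≈⟨ multiples-difference (u * g) x y ⟨
        multiples (u * g) x - multiples (u * g) y ∎)

    Multiples-isDifferenceSetOfDim : IsDifferenceSetOfDim +-group q q k λ′ Multiples
    Multiples-isDifferenceSetOfDim = record
      { size        = Multiples-size
      ; differences = λ x y x<y →
          -- Distinct coordinates carry distinct scalars, whose difference is therefore a unit.
          let u , uv≈1 = ≉⇒leftInvertible (element-≉ (Fin.<⇒≢ x<y)) in
          preimage-isDifferenceSet +-group (scaling uv≈1) (x[y-z]≈xy-xz u)
            (Multiples-differences x y uv≈1) isD
      }

    D≐Multiples-differences : D ≐ Differences +-group Multiples oneᵢ zeroᵢ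
    D≐Multiples-differences =
      (λ {d} d∈D → ⊇ (respects (sym (*-identityˡ d)) d∈D)) ,
      (λ {d} d∈ → respects (*-identityˡ d) (⊆ d∈))
      where
      -- Here the scalar is 1 - 0, so `u` can be taken to be `1#`, and the preimage under `1# *_` is
      -- `D` itself.
      ⊆⊇ = Multiples-differences oneᵢ zeroᵢ (trans (*-identityˡ _) one-zero≈1)
      ⊆ = proj₁ ⊆⊇
      ⊇ = proj₂ ⊆⊇

theorem4p4 : ∀ {c ℓ₁ ℓ₂ p : Level} (F : HeytingField c ℓ₁ ℓ₂) (q : ℕ) →
    IsFiniteFieldOfOrder F q →
    ∀ (k λ′ : ℕ) (D : Pred (HeytingField.Carrier F) p) →
    IsDifferenceSet (additiveGroup F) q k λ′ D →
    ExtendsToDimension (additiveGroup F) q q k λ′ D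
theorem4p4 F q order k λ′ D isD =
  Multiples isD , Multiples-isDifferenceSetOfDim isD ,
  oneᵢ , zeroᵢ , oneᵢ≢zeroᵢ , D≐Multiples-differences isD
  where open FiniteField F order
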